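{- Let $r\ge 3$ and let $\mathcal{H}$ be an $r$-uniform $r$-partite linear hypergraph (with a fixed partition of its vertex set into parts $V_1,\dots,V_r$) which contains no rainbow cycles of length three or four. Then $\mathcal{H}$ is $\mathcal{G}_r(3r-3,3)$-free, $\mathcal{G}_r(4r-5,4)$-free, $\mathcal{G}_r(5r-7,5)$-free, $\mathcal{G}_r(7r-11,7)$-free and $\mathcal{G}_r(8r-13,8)$-free.
   Context: A hypergraph is linear if any two distinct edges share at most one vertex. An $r$-uniform hypergraph is $r$-partite if its vertex set is partitioned into $r$ parts $V_1,\dots,V_r$ such that every edge contains exactly one vertex of each part. A cycle of length $k$ in a hypergraph is a sequence $v_1,A_1,v_2,A_2,\dots,v_k,A_k,v_1$ where $v_1,\dots,v_k$ are distinct vertices, $A_1,\dots,A_k$ are distinct edges, $v_i,v_{i+1}\in A_i$ for $1\le i\le k-1$ and $v_k,v_1\in A_k$. In an $r$-uniform $r$-partite linear hypergraph such a cycle is a rainbow $k$-cycle if $v_1,\dots,v_k$ lie in $k$ pairwise different parts. For integers $v,e$, an $r$-uniform hypergraph is $\mathcal{G}_r(v,e)$-free if the union of any $e$ distinct edges has at least $v+1$ vertices. -}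

module Defs where

open import Data.Nat using (ℕ; zero; suc; _+_; _≤_; NonZero)
open import Relation.Nullary using (¬_)
open import Data.Nat.DivMod using (_mod_)
open import Data.Fin using (Fin; toℕ)
open import Data.Fin.Subset using (Subset; _∈_; ⋃; ∣_∣)
open import Data.List using (tabulate)
open import Data.Product using (Σ; _×_; ∃)
open import Function.Definitions using (Injective)
open import Relation.Binary.PropositionalEquality using (_≡_; _≢_)

-- A hypergraph on the vertex set Fin n is given by a predicate E on
-- subsets of Fin n (E A means: A is an edge).  An r-partition of the
-- vertex set is a map part : Fin n → Fin r (V_i = part ⁻¹ i).

-- every edge contains exactly one vertex of each part
-- (this also makes the hypergraph r-uniform)
IsRPartite : ∀ {n r} → (Fin n → Fin r) → (Subset n → Set) → Set
IsRPartite {n} {r} part E =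
  ∀ A → E A → ∀ (i : Fin r) →
    Σ (Fin n) λ v → (v ∈ A) × (part v ≡ i) ×
      (∀ w → w ∈ A → part w ≡ i → w ≡ v)

IsLinear : ∀ {n} → (Subset n → Set) → Set
IsLinear {n} E =
  ∀ A B → E A → E B → A ≢ B →
    ∀ (u v : Fin n) → u ∈ A → v ∈ A → u ∈ B → v ∈ B → u ≡ v

next : ∀ {k} .{{_ : NonZero k}} → Fin k → Fin k
next {k} i = suc (toℕ i) mod k

record Cycle {n} (E : Subset n → Set) (k : ℕ) .{{_ : NonZero k}} : Set where
  field
    vtx      : Fin k → Fin n
    edg      : Fin k → Subset n
    vtx-inj  : Injective _≡_ _≡_ vtx
    edg-inj  : Injective _≡_ _≡_ edg
    edg-E    : ∀ i → E (edg i)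
    vtx-here : ∀ i → vtx i ∈ edg i
    vtx-next : ∀ i → vtx (next i) ∈ edg i

IsRainbow : ∀ {n r k} .{{_ : NonZero k}} {E : Subset n → Set} →
            (Fin n → Fin r) → Cycle E k → Set
IsRainbow part C = Injective _≡_ _≡_ (λ i → part (Cycle.vtx C i))

NoRainbowCycle : ∀ {n r} → (Fin n → Fin r) → (Subset n → Set) →
                 (k : ℕ) .{{_ : NonZero k}} → Set
NoRainbowCycle part E k = (C : Cycle E k) → ¬ IsRainbow part C

GFree : ∀ {n} → (Subset n → Set) → ℕ → ℕ → Set
GFree {n} E v e =
  ∀ (As : Fin e → Subset n) → Injective _≡_ _≡_ As → (∀ j → E (As j)) →
    suc v ≤ ∣ ⋃ (tabulate As) ∣

{-# OPTIONS --safe #-}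
module Submission where

-- Call two edges linked when they share a vertex v and one of them is a chosen "root" edge of v;
-- this turns the edges through v into a star, so the e edges span at least e r − m vertices, where m is
-- the number of links.  A triangle is always rainbow, so the link graph is triangle-free and each of its
-- 4-cycles is a genuine 4-cycle of the hypergraph.  Colour a link by the part of its meeting
-- vertex: 4-cycles are properly coloured and not rainbow.  Hence every K₂₃ carries a cyclic Latin pattern on
-- three colours, which excludes K₂₄ and K₄₄ minus three independent edges.  Splitting the graph into a
-- vertex u of maximum degree, its neighbours N and the remaining vertices W then gives m ≤ 2e − 4 for the
-- required e (for e = 6, K₃₃ with a Latin square has 9 edges).
open import Defs
open import Data.Empty using (⊥; ⊥-elim)
open import Data.Fin as Fin using (Fin; zero; suc)
import Data.Fin.Properties as Fin
open import Data.Fin.Subset using (Subset; ∣_∣; inside; outside; ⋃; _∈_)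
open import Data.Fin.Subset.Properties using (_∈?_; p⊆p∪q; q⊆p∪q)
open import Data.List.Base using (List; []; _∷_; _++_; map; filter; length; lookup; tabulate; allFin)
open import Data.List.Membership.Propositional using () renaming (_∈_ to _∈ₗ_)
open import Data.List.Membership.Propositional.Properties using (∈-lookup; ∈-allFin)
open import Data.List.Properties using (map-++; map-tabulate; length-++; length-tabulate; filter-all; filter-accept; filter-reject)
open import Data.List.Relation.Binary.Permutation.Propositional using (_↭_; prep; swap; ↭-refl; ↭-sym; ↭-trans; ↭-reflexive)
open import Data.List.Relation.Binary.Permutation.Propositional.Properties using (shift; map⁺; ↭-length)
open import Data.List.Relation.Unary.All as All using (All; []; _∷_)
import Data.List.Relation.Unary.All.Properties as All
open import Data.List.Relation.Unary.AllPairs using (AllPairs; []; _∷_)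
open import Data.List.Relation.Unary.Any using (here; there)
open import Data.List.Relation.Unary.Unique.Propositional using (Unique)
import Data.List.Relation.Unary.Unique.Propositional.Properties as Unique
open import Data.Nat using (ℕ; zero; suc; _+_; _*_; _∸_; _⊓_; _≤_; z≤n; s≤s; s≤s⁻¹)
open import Data.Nat.ListAction using (sum)
open import Data.Nat.ListAction.Properties using (sum-↭; sum-++)
open import Data.Nat.Properties
open import Data.List.Extrema ≤-totalOrder using (argmax; argmax-sel; f[xs]≤f[argmax])
open import Data.Nat.Tactic.RingSolver using (solve-∀)
open import Data.Product using (∃; ∃₂; _×_; _,_; proj₁; proj₂)
open import Data.Sum using (_⊎_; inj₁; inj₂)
open import Data.Vec.Base using ([]; _∷_)
open import Function using (_∘_; id)
open import Function.Definitions using (Injective)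
open import Level using (0ℓ)
open import Relation.Binary using (DecidableEquality)
open import Relation.Binary.PropositionalEquality
open import Relation.Nullary using (Dec; yes; no; ¬_; contradiction)
open import Relation.Nullary.Decidable using (_×-dec_; _⊎-dec_; ¬?; from-yes; map′)
open import Relation.Unary as Unary using (Pred)


-- Finite sums and indicators over lists.

private variable
  A B P Q : Set
  xs ys : List A

∑ : List A → (A → ℕ) → ℕ
∑ xs f = sum (map f xs)

χ : Dec P → ℕ
χ (yes _) = 1
χ (no _)  = 0

χ≤1 : (p : Dec P) → χ p ≤ 1
χ≤1 (yes _) = ≤-refl
χ≤1 (no _)  = z≤n

χ-yes : (p : Dec P) → P → χ p ≡ 1
χ-yes (yes _) _ = refl
χ-yes (no ¬p) p = contradiction p ¬p

χ-no : (p : Dec P) → ¬ P → χ p ≡ 0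
χ-no (yes p) ¬p = contradiction p ¬p
χ-no (no _)  _  = refl

χ-mono : (p : Dec P) (q : Dec Q) → (P → Q) → χ p ≤ χ q
χ-mono (yes p) q f = ≤-reflexive (sym (χ-yes q (f p)))
χ-mono (no _)  q f = z≤n

∑-cong : ∀ xs {f g : A → ℕ} → (∀ x → f x ≡ g x) → ∑ xs f ≡ ∑ xs g
∑-cong []       h = refl
∑-cong (x ∷ xs) h = cong₂ _+_ (h x) (∑-cong xs h)

∑-mono-All : ∀ {xs} {f g : A → ℕ} → All (λ x → f x ≤ g x) xs → ∑ xs f ≤ ∑ xs g
∑-mono-All []       = z≤n
∑-mono-All (p ∷ ps) = +-mono-≤ p (∑-mono-All ps)

∑-mono : ∀ xs {f g : A → ℕ} → (∀ x → f x ≤ g x) → ∑ xs f ≤ ∑ xs g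
∑-mono xs h = ∑-mono-All (All.universal h xs)

∑-const : ∀ (xs : List A) k → ∑ xs (λ _ → k) ≡ length xs * k
∑-const []       k = refl
∑-const (x ∷ xs) k = cong (k +_) (∑-const xs k)

∑-const-All : ∀ {xs} {f : A → ℕ} {k} → All (λ x → f x ≡ k) xs → ∑ xs f ≡ length xs * k
∑-const-All []       = refl
∑-const-All (p ∷ ps) = cong₂ _+_ p (∑-const-All ps)

∑-≤-* : ∀ (xs : List A) {f : A → ℕ} {k} → (∀ x → f x ≤ k) → ∑ xs f ≤ length xs * k
∑-≤-* xs h = ≤-trans (∑-mono xs h) (≤-reflexive (∑-const xs _))

∑-+ : ∀ xs (f g : A → ℕ) → ∑ xs (λ x → f x + g x) ≡ ∑ xs f + ∑ xs g
∑-+ []       f g = refl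
∑-+ (x ∷ xs) f g = trans (cong (f x + g x +_) (∑-+ xs f g)) (interchange (f x) (g x) _ _)
  where
  interchange : ∀ a b c d → (a + b) + (c + d) ≡ (a + c) + (b + d)
  interchange = solve-∀

∑-++ : ∀ xs ys (f : A → ℕ) → ∑ (xs ++ ys) f ≡ ∑ xs f + ∑ ys f
∑-++ xs ys f = trans (cong sum (map-++ f xs ys)) (sum-++ (map f xs) (map f ys))

∑-↭ : (f : A → ℕ) → xs ↭ ys → ∑ xs f ≡ ∑ ys f
∑-↭ f p = sum-↭ (map⁺ f p)

∑-swap : ∀ xs ys (f : A → B → ℕ) →
         ∑ xs (λ x → ∑ ys (f x)) ≡ ∑ ys (λ y → ∑ xs (λ x → f x y))
∑-swap []       ys f = sym (trans (∑-const ys 0) (*-zeroʳ (length ys)))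
∑-swap (x ∷ xs) ys f = trans (cong (∑ ys (f x) +_) (∑-swap xs ys f)) (sym (∑-+ ys (f x) _))

∈⇒≤∑ : ∀ (f : A → ℕ) {x} → x ∈ₗ xs → f x ≤ ∑ xs f
∈⇒≤∑ f (here refl) = m≤m+n _ _
∈⇒≤∑ f (there x∈)  = ≤-trans (∈⇒≤∑ f x∈) (m≤n+m _ _)

-- Uniqueness leaves at most one nonzero term, and a solution of `P` forces `Q`. Every later step
-- that counts each object once rests on this: one part per vertex, one root per vertex, one vertex
-- per arc.
∑χ-unique : ∀ {P : Pred A 0ℓ} (P? : Unary.Decidable P) → (∀ {x y} → P x → P y → x ≡ y) →
            (q : Dec Q) → (∀ {x} → P x → Q) → ∀ {xs} → Unique xs → ∑ xs (χ ∘ P?) ≤ χ q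
∑χ-unique P? uniq q P⇒Q [] = z≤n
∑χ-unique P? uniq q P⇒Q {x ∷ xs} (x∉ ∷ u) with P? x
... | no _   = ∑χ-unique P? uniq q P⇒Q u
... | yes px = begin
  1 + ∑ xs (χ ∘ P?)  ≡⟨ cong suc (∑-const-All (All.map (λ x≢y → χ-no (P? _) (x≢y ∘ uniq px)) x∉)) ⟩
  1 + length xs * 0  ≡⟨ cong suc (*-zeroʳ (length xs)) ⟩
  1                  ≡⟨ χ-yes q (P⇒Q px) ⟨
  χ q                ∎
  where open ≤-Reasoning

∑-allFin-suc : ∀ {n} (f : Fin (suc n) → ℕ) → ∑ (allFin (suc n)) f ≡ f zero + ∑ (allFin n) (f ∘ suc)
∑-allFin-suc {n} f = cong (λ l → f zero + sum l)
  (trans (map-tabulate {n = n} suc f) (sym (map-tabulate {n = n} id (f ∘ suc))))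

length-filter : ∀ {P : Pred A 0ℓ} (P? : Unary.Decidable P) xs → length (filter P? xs) ≡ ∑ xs (χ ∘ P?)
length-filter P? [] = refl
length-filter P? (x ∷ xs) with P? x
... | yes _ = cong suc (length-filter P? xs)
... | no _  = length-filter P? xs

filter-split-↭ : ∀ {P : Pred A 0ℓ} (P? : Unary.Decidable P) xs →
                 xs ↭ filter P? xs ++ filter (¬? ∘ P?) xs
filter-split-↭ P? [] = ↭-refl
filter-split-↭ P? (x ∷ xs) with P? x
... | yes _ = prep x (filter-split-↭ P? xs)
... | no _  = ↭-trans (prep x (filter-split-↭ P? xs)) (↭-sym (shift x (filter P? xs) _))

χ-∈?-suc : ∀ {n} s (p : Subset n) v → χ (suc v ∈? (s ∷ p)) ≡ χ (v ∈? p)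
χ-∈?-suc s p v with v ∈? p
... | yes _ = refl
... | no _  = refl

∣p∣≡∑ : ∀ {n} (p : Subset n) → ∣ p ∣ ≡ ∑ (allFin n) (λ v → χ (v ∈? p))
∣p∣≡∑ []      = refl
∣p∣≡∑ (s ∷ p) = begin
  ∣ s ∷ p ∣                                                ≡⟨ ∣∷∣ s ⟩
  χ (zero ∈? (s ∷ p)) + ∣ p ∣                              ≡⟨ cong (χ (zero ∈? (s ∷ p)) +_) (∣p∣≡∑ p) ⟩
  χ (zero ∈? (s ∷ p)) + ∑ (allFin _) (λ v → χ (v ∈? p))    ≡⟨ cong (χ (zero ∈? (s ∷ p)) +_) (∑-cong (allFin _) (χ-∈?-suc s p)) ⟨
  χ (zero ∈? (s ∷ p)) + ∑ (allFin _) (λ v → χ (suc v ∈? (s ∷ p)))  ≡⟨ ∑-allFin-suc (λ v → χ (v ∈? (s ∷ p))) ⟨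
  ∑ (allFin _) (λ v → χ (v ∈? (s ∷ p)))                    ∎
  where
  open ≡-Reasoning
  ∣∷∣ : ∀ s → ∣ s ∷ p ∣ ≡ χ (zero ∈? (s ∷ p)) + ∣ p ∣
  ∣∷∣ inside  = refl
  ∣∷∣ outside = refl


-- Indexing into lists, nearly full predicates, removal.

lookup-injective : ∀ {B : Set} (f : A → B) {xs} → AllPairs (λ x y → f x ≢ f y) xs →
                   ∀ {i j} → f (lookup xs i) ≡ f (lookup xs j) → i ≡ j
lookup-injective f (x∉ ∷ u) {zero}  {zero}  eq = refl
lookup-injective f (x∉ ∷ u) {zero}  {suc j} eq = ⊥-elim (All.lookup x∉ (∈-lookup j) eq)
lookup-injective f (x∉ ∷ u) {suc i} {zero}  eq = ⊥-elim (All.lookup x∉ (∈-lookup i) (sym eq))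
lookup-injective f (x∉ ∷ u) {suc i} {suc j} eq = cong suc (lookup-injective f u eq)

lookup-≢ : ∀ {xs : List A} → Unique xs → ∀ {i j} → i ≢ j → lookup xs i ≢ lookup xs j
lookup-≢ u i≢j = i≢j ∘ lookup-injective id u

full⇒All : ∀ {P : Pred A 0ℓ} (P? : Unary.Decidable P) xs → length xs ≤ ∑ xs (χ ∘ P?) → All P xs
full⇒All P? [] _ = []
full⇒All P? (x ∷ xs) h with P? x
... | yes p = p ∷ full⇒All P? xs (s≤s⁻¹ h)
... | no _  = ⊥-elim (<-irrefl refl (≤-trans h (≤-trans (∑-≤-* xs (χ≤1 ∘ P?)) (≤-reflexive (*-identityʳ _)))))

-- The hypothesis permits a single failure, since `xs` is one shorter than the full list. The index
-- `m` marks the possible failure; when nothing fails it is merely some index.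
all-but-one : ∀ {P : Pred A 0ℓ} (P? : Unary.Decidable P) x xs → length xs ≤ ∑ (x ∷ xs) (χ ∘ P?) →
              ∃ λ m → ∀ {j} → j ≢ m → P (lookup (x ∷ xs) j)
all-but-one P? x xs h with P? x
... | no _ = zero , λ { {zero} j≢ → ⊥-elim (j≢ refl) ; {suc j} _ → All.lookup (full⇒All P? xs h) (∈-lookup j) }
all-but-one P? x [] h | yes p = zero , λ { {zero} _ → p }
all-but-one P? x (y ∷ ys) h | yes p with all-but-one P? y ys (s≤s⁻¹ h)
... | m , f = suc m , λ { {zero} _ → p ; {suc j} j≢ → f (j≢ ∘ cong suc) }

↭-remove : (_≟_ : DecidableEquality A) → ∀ {x xs} → Unique xs → x ∈ₗ xs →
           xs ↭ x ∷ filter (¬? ∘ (x ≟_)) xs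
↭-remove _≟_ {x} {_ ∷ xs} (x∉ ∷ u) (here refl) = prep x (↭-reflexive (sym
  (trans (filter-reject (¬? ∘ (x ≟_)) (λ ¬p → ¬p refl)) (filter-all (¬? ∘ (x ≟_)) x∉))))
↭-remove _≟_ {x} {y ∷ xs} (y∉ ∷ u) (there x∈) = ↭-trans
  (prep y (↭-remove _≟_ u x∈))
  (↭-trans (swap y x ↭-refl) (prep x (↭-reflexive (sym
    (filter-accept (¬? ∘ (x ≟_)) (λ x≡y → All.lookup y∉ x∈ (sym x≡y)))))))

abstract
  -- Decided by exhaustion; `abstract` keeps the search from being unfolded where the result is
  -- used.
  avoid-two : ∀ (a b : Fin 4) → ∃₂ λ k l → k ≢ l × (k ≢ a × k ≢ b) × (l ≢ a × l ≢ b)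
  avoid-two = from-yes (Fin.all? {4} λ a → Fin.all? {4} λ b → Fin.any? {4} λ k → Fin.any? {4} λ l →
    ¬? (k Fin.≟ l) ×-dec (¬? (k Fin.≟ a) ×-dec ¬? (k Fin.≟ b)) ×-dec (¬? (l Fin.≟ a) ×-dec ¬? (l Fin.≟ b)))

  avoid-three : ∀ (a b c : Fin 4) → ∃ λ k → k ≢ a × k ≢ b × k ≢ c
  avoid-three = from-yes (Fin.all? {4} λ a → Fin.all? {4} λ b → Fin.all? {4} λ c → Fin.any? {4} λ k →
    ¬? (k Fin.≟ a) ×-dec ¬? (k Fin.≟ b) ×-dec ¬? (k Fin.≟ c))

-- Coloured graphs and their forbidden bipartite subgraphs.

-- The colour conditions concern a 4-cycle x z y w with opposite pairs {x , y} and {z , w}.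
record ColouredGraph : Set₁ where
  field
    V C     : Set
    Adj     : V → V → Set
    adj?    : ∀ x y → Dec (Adj x y)
    adj-sym : ∀ {x y} → Adj x y → Adj y x
    colour  : ∀ {x y} → Adj x y → C
    triangle-free : ∀ {x y z} → Adj x y → Adj y z → Adj x z → ⊥
    proper-row : ∀ {x y z w} → x ≢ y → z ≢ w →
      (xz : Adj x z) (xw : Adj x w) (yz : Adj y z) (yw : Adj y w) → colour xz ≢ colour xw
    proper-column : ∀ {x y z w} → x ≢ y → z ≢ w →
      (xz : Adj x z) (xw : Adj x w) (yz : Adj y z) (yw : Adj y w) → colour xz ≢ colour yz
    not-rainbow : ∀ {x y z w} → x ≢ y → z ≢ w →
      (xz : Adj x z) (xw : Adj x w) (yz : Adj y z) (yw : Adj y w) →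
      colour xz ≡ colour yw ⊎ colour xw ≡ colour yz

module Counting (G : ColouredGraph) where
  open ColouredGraph G

  -- Each of the three 4-cycles has a diagonal pair of equal colours. Two such equations sharing a
  -- link would repeat a colour within a row, so the three choices agree: the row of `y` is the row
  -- of `x` shifted cyclically, in one direction or the other.
  K₂₃-cyclic : ∀ {x y z₁ z₂ z₃} → x ≢ y → z₁ ≢ z₂ → z₁ ≢ z₃ → z₂ ≢ z₃ →
    (a₁ : Adj x z₁) (a₂ : Adj x z₂) (a₃ : Adj x z₃)
    (b₁ : Adj y z₁) (b₂ : Adj y z₂) (b₃ : Adj y z₃) →
    (colour a₁ ≡ colour b₂ × colour a₂ ≡ colour b₃ × colour a₃ ≡ colour b₁) ⊎
    (colour b₁ ≡ colour a₂ × colour b₂ ≡ colour a₃ × colour b₃ ≡ colour a₁)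
  K₂₃-cyclic x≢y n₁₂ n₁₃ n₂₃ a₁ a₂ a₃ b₁ b₂ b₃
    with not-rainbow x≢y n₁₂ a₁ a₂ b₁ b₂
       | not-rainbow x≢y n₁₃ a₁ a₃ b₁ b₃
       | not-rainbow x≢y n₂₃ a₂ a₃ b₂ b₃
  ... | inj₁ p | inj₁ q | _      = ⊥-elim (proper-row (x≢y ∘ sym) n₂₃ b₂ b₃ a₂ a₃ (trans (sym p) q))
  ... | inj₁ p | inj₂ q | inj₁ s = inj₁ (p , s , q)
  ... | inj₁ p | inj₂ q | inj₂ s = ⊥-elim (proper-row (x≢y ∘ sym) n₁₂ b₁ b₂ a₁ a₂ (trans (sym q) s))
  ... | inj₂ p | inj₁ q | inj₁ s = ⊥-elim (proper-row (x≢y ∘ sym) n₁₃ b₁ b₃ a₁ a₃ (trans (sym p) s))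
  ... | inj₂ p | inj₁ q | inj₂ s = inj₂ (sym p , sym s , sym q)
  ... | inj₂ p | inj₂ q | _      = ⊥-elim (proper-row x≢y n₂₃ a₂ a₃ b₂ b₃ (trans p (sym q)))

  -- The column triples 1, 2, 3 and 1, 2, 4 are both cyclic shifts. Comparing them on the shared
  -- columns repeats a colour in one row, whatever the two directions are.
  no-K₂₄ : ∀ {x y z₁ z₂ z₃ z₄} → x ≢ y → Unique (z₁ ∷ z₂ ∷ z₃ ∷ z₄ ∷ []) →
    All (λ z → Adj x z × Adj y z) (z₁ ∷ z₂ ∷ z₃ ∷ z₄ ∷ []) → ⊥
  no-K₂₄ x≢y ((n₁₂ ∷ n₁₃ ∷ n₁₄ ∷ _) ∷ (n₂₃ ∷ n₂₄ ∷ _) ∷ (n₃₄ ∷ _) ∷ _)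
         ((a₁ , b₁) ∷ (a₂ , b₂) ∷ (a₃ , b₃) ∷ (a₄ , b₄) ∷ _)
    with K₂₃-cyclic x≢y n₁₂ n₁₃ n₂₃ a₁ a₂ a₃ b₁ b₂ b₃
       | K₂₃-cyclic x≢y n₁₂ n₁₄ n₂₄ a₁ a₂ a₄ b₁ b₂ b₄
  ... | inj₁ (_ , p , _) | inj₁ (_ , q , _) = proper-row (x≢y ∘ sym) n₃₄ b₃ b₄ a₃ a₄ (trans (sym p) q)
  ... | inj₁ (p , _ , _) | inj₂ (_ , q , _) = proper-row x≢y n₁₄ a₁ a₄ b₁ b₄ (trans p q)
  ... | inj₂ (_ , p , _) | inj₁ (q , _ , _) = proper-row x≢y n₁₃ a₁ a₃ b₁ b₃ (trans q p)
  ... | inj₂ (_ , p , _) | inj₂ (_ , q , _) = proper-row x≢y n₃₄ a₃ a₄ b₃ b₄ (trans (sym p) q)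

  -- Each `wᵢ` misses only `zᵢ`, so together with `u` it spans a K₂₃ on the other three columns and
  -- its row is a shift of the row of `u`. This leaves eight choices of directions to refute.
  no-K₄₄-minus-3K₂ : ∀ {u w₁ w₂ w₃ z₀ z₁ z₂ z₃} →
    Unique (u ∷ w₁ ∷ w₂ ∷ w₃ ∷ []) → Unique (z₀ ∷ z₁ ∷ z₂ ∷ z₃ ∷ []) →
    All (Adj u) (z₀ ∷ z₁ ∷ z₂ ∷ z₃ ∷ []) → All (Adj w₁) (z₀ ∷ z₂ ∷ z₃ ∷ []) →
    All (Adj w₂) (z₀ ∷ z₁ ∷ z₃ ∷ []) → All (Adj w₃) (z₀ ∷ z₁ ∷ z₂ ∷ []) → ⊥
  no-K₄₄-minus-3K₂
    ((u≢₁ ∷ u≢₂ ∷ u≢₃ ∷ _) ∷ (w₁₂ ∷ w₁₃ ∷ _) ∷ (w₂₃ ∷ _) ∷ _)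
    ((n₀₁ ∷ n₀₂ ∷ n₀₃ ∷ _) ∷ (n₁₂ ∷ n₁₃ ∷ _) ∷ (n₂₃ ∷ _) ∷ _)
    (a ∷ b ∷ c ∷ d ∷ _) (p₀ ∷ p₂ ∷ p₃ ∷ _) (q₀ ∷ q₁ ∷ q₃ ∷ _) (r₀ ∷ r₁ ∷ r₂ ∷ _)
    with K₂₃-cyclic u≢₁ n₀₂ n₀₃ n₂₃ a c d p₀ p₂ p₃
       | K₂₃-cyclic u≢₂ n₀₁ n₀₃ n₁₃ a b d q₀ q₁ q₃
       | K₂₃-cyclic u≢₃ n₀₁ n₀₂ n₁₂ a b c r₀ r₁ r₂
       | not-rainbow w₁₂ n₀₃ p₀ p₃ q₀ q₃
  -- Column `z₀` must show three different colours, which rules out six of the eight choices. In the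
  -- other two, the 4-cycle on `w₁`, `w₂`, `z₀`, `z₃` would give two links at `u` the same colour.
  ... | inj₁ (_ , _ , p) | inj₁ (_ , _ , q) | _ | _ = proper-column w₁₂ n₀₃ p₀ p₃ q₀ q₃ (trans (sym p) q)
  ... | _ | inj₂ (q , _ , _) | inj₂ (r , _ , _) | _ = proper-column w₂₃ n₀₁ q₀ q₁ r₀ r₁ (trans q (sym r))
  ... | inj₂ (p , _ , _) | _ | inj₁ (_ , _ , r) | _ = proper-column w₁₃ n₀₂ p₀ p₂ r₀ r₂ (trans p r)
  ... | inj₁ (_ , p , p′) | inj₂ (q , _ , q′) | inj₁ _ | inj₁ s = proper-row u≢₁ n₀₃ a d p₀ p₃ (sym (trans p′ (trans s q′)))
  ... | inj₁ (_ , p , p′) | inj₂ (q , _ , q′) | inj₁ _ | inj₂ s = proper-row u≢₃ n₁₂ b c r₁ r₂ (sym (trans p (trans s q)))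
  ... | inj₂ (p , _ , p′) | inj₁ (_ , q , q′) | inj₂ _ | inj₁ s = proper-row u≢₃ n₁₂ b c r₁ r₂ (trans q (trans (sym s) p))
  ... | inj₂ (p , _ , p′) | inj₁ (_ , q , q′) | inj₂ _ | inj₂ s = proper-row u≢₁ n₀₃ a d p₀ p₃ (trans (sym p′) (trans s (sym q′)))

  -- Edge counts and the decomposition at a vertex of maximum degree.

  α : V → V → ℕ
  α x y = χ (adj? x y)

  -- Ordered pairs are counted, so e⟨ X , X ⟩ is twice the number of edges inside X.
  e⟨_,_⟩ : List V → List V → ℕ
  e⟨ X , Y ⟩ = ∑ X (λ x → ∑ Y (α x))

  -- A loop is a degenerate triangle, so `triangle-free` also gives irreflexivity.
  α-refl : ∀ x → α x x ≡ 0
  α-refl x = χ-no (adj? x x) (λ a → triangle-free a a a)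

  α-sym : ∀ x y → α x y ≡ α y x
  α-sym x y = ≤-antisym (χ-mono (adj? x y) (adj? y x) adj-sym) (χ-mono (adj? y x) (adj? x y) adj-sym)

  e-sym : ∀ X Y → e⟨ X , Y ⟩ ≡ e⟨ Y , X ⟩
  e-sym X Y = trans (∑-swap X Y α) (∑-cong Y (λ y → ∑-cong X (λ x → α-sym x y)))

  e-++ʳ : ∀ X Y Z → e⟨ X , Y ++ Z ⟩ ≡ e⟨ X , Y ⟩ + e⟨ X , Z ⟩
  e-++ʳ X Y Z = trans (∑-cong X (λ x → ∑-++ Y Z (α x))) (∑-+ X _ _)

  e-↭ : ∀ {X Y} → X ↭ Y → e⟨ X , X ⟩ ≡ e⟨ Y , Y ⟩
  e-↭ {X} {Y} p = trans (∑-cong X (λ x → ∑-↭ (α x) p)) (∑-↭ (λ x → ∑ Y (α x)) p)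

  codegree≤3 : ∀ {x y} → x ≢ y → ∀ {L} → Unique L → ∑ L (λ z → χ (adj? x z ×-dec adj? y z)) ≤ 3
  codegree≤3 {x} {y} x≢y {L} uL = subst (_≤ 3) (length-filter both? L)
    (bound (Unique.filter⁺ both? uL) (All.all-filter both? L))
    where
    both? = λ z → adj? x z ×-dec adj? y z
    bound : ∀ {L} → Unique L → All (λ z → Adj x z × Adj y z) L → length L ≤ 3
    bound {[]}                    _ _ = z≤n
    bound {_ ∷ []}                _ _ = s≤s z≤n
    bound {_ ∷ _ ∷ []}            _ _ = s≤s (s≤s z≤n)
    bound {_ ∷ _ ∷ _ ∷ []}        _ _ = ≤-refl
    bound {_ ∷ _ ∷ _ ∷ _ ∷ _}
      ((n₁₂ ∷ n₁₃ ∷ n₁₄ ∷ _) ∷ (n₂₃ ∷ n₂₄ ∷ _) ∷ (n₃₄ ∷ _) ∷ _) (a₁ ∷ a₂ ∷ a₃ ∷ a₄ ∷ _) =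
      ⊥-elim (no-K₂₄ x≢y ((n₁₂ ∷ n₁₃ ∷ n₁₄ ∷ []) ∷ (n₂₃ ∷ n₂₄ ∷ []) ∷ (n₃₄ ∷ []) ∷ [] ∷ []) (a₁ ∷ a₂ ∷ a₃ ∷ a₄ ∷ []))

  -- `length N` is the degree of `u`, so `maximal` is the form in which maximality enters: the
  -- degree sum is at most the number of vertices times the largest degree.
  record Star (vs : List V) : Set where
    field
      u           : V
      N W         : List V
      split       : vs ↭ u ∷ N ++ W
      unique-N    : Unique N
      unique-W    : Unique W
      u≢W         : All (u ≢_) W
      adjacent    : All (Adj u) N
      nonadjacent : All (λ w → ¬ Adj u w) W
      maximal     : e⟨ vs , vs ⟩ ≤ length vs * length N

    W≢N : All (λ w → All (w ≢_) N) W
    W≢N = All.map (λ ¬uw → All.map (λ uz → λ { refl → ¬uw uz }) adjacent) nonadjacent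

    e-NN : e⟨ N , N ⟩ ≡ 0
    e-NN = trans (∑-const-All (All.map (λ {x} ux → trans (∑-const-All (All.map (λ {y} uy →
             χ-no (adj? x y) (λ xy → triangle-free ux xy uy)) adjacent)) (*-zeroʳ (length N))) adjacent)) (*-zeroʳ (length N))

    degree-u : ∑ (u ∷ N ++ W) (α u) ≡ length N
    degree-u = begin
      α u u + ∑ (N ++ W) (α u)      ≡⟨ cong₂ _+_ (α-refl u) (∑-++ N W (α u)) ⟩
      ∑ N (α u) + ∑ W (α u)         ≡⟨ cong₂ _+_ (∑-const-All (All.map (χ-yes (adj? u _)) adjacent)) (∑-const-All (All.map (χ-no (adj? u _)) nonadjacent)) ⟩
      length N * 1 + length W * 0   ≡⟨ cong₂ _+_ (*-identityʳ (length N)) (*-zeroʳ (length W)) ⟩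
      length N + 0                  ≡⟨ +-identityʳ _ ⟩
      length N                      ∎
      where open ≡-Reasoning

    -- No edge lies inside `N`, by triangle-freeness, and none joins `u` to `W`. The remaining edges
    -- at `u` and between `W` and `N` appear in both orders.
    e-total : e⟨ vs , vs ⟩ ≡ 2 * (length N + e⟨ W , N ⟩) + e⟨ W , W ⟩
    e-total = begin
      e⟨ vs , vs ⟩                                             ≡⟨ e-↭ split ⟩
      ∑ vs′ (α u) + e⟨ N ++ W , vs′ ⟩                          ≡⟨ cong (∑ vs′ (α u) +_) (e-sym (N ++ W) vs′) ⟩
      ∑ vs′ (α u) + (∑ (N ++ W) (α u) + e⟨ N ++ W , N ++ W ⟩)  ≡⟨ cong (λ k → ∑ vs′ (α u) + (k + ∑ (N ++ W) (α u) + e⟨ N ++ W , N ++ W ⟩)) (α-refl u) ⟨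
      ∑ vs′ (α u) + (∑ vs′ (α u) + e⟨ N ++ W , N ++ W ⟩)       ≡⟨ cong (λ k → k + (k + e⟨ N ++ W , N ++ W ⟩)) degree-u ⟩
      length N + (length N + e⟨ N ++ W , N ++ W ⟩)             ≡⟨ cong (λ k → length N + (length N + k)) rest ⟩
      length N + (length N + (0 + e⟨ W , N ⟩ + (e⟨ W , N ⟩ + e⟨ W , W ⟩)))  ≡⟨ arith (length N) e⟨ W , N ⟩ e⟨ W , W ⟩ ⟩
      2 * (length N + e⟨ W , N ⟩) + e⟨ W , W ⟩                 ∎
      where
      open ≡-Reasoning
      vs′ = u ∷ N ++ W
      rest : e⟨ N ++ W , N ++ W ⟩ ≡ 0 + e⟨ W , N ⟩ + (e⟨ W , N ⟩ + e⟨ W , W ⟩)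
      rest = trans (e-++ʳ (N ++ W) N W) (cong₂ _+_
        (trans (∑-++ N W _) (cong (_+ e⟨ W , N ⟩) e-NN))
        (trans (∑-++ N W _) (cong (_+ e⟨ W , W ⟩) (e-sym N W))))
      arith : ∀ n a b → n + (n + (0 + a + (a + b))) ≡ 2 * (n + a) + b
      arith = solve-∀

    length-split : length vs ≡ suc (length N + length W)
    length-split = trans (↭-length split) (cong suc (length-++ N))

    -- The neighbours of `w` in `N` are common neighbours of `u` and `w`.
    to-N≤3 : ∀ {w} → u ≢ w → ∑ N (α w) ≤ 3
    to-N≤3 {w} u≢w = ≤-trans
      (∑-mono-All (All.map (λ {z} uz → χ-mono (adj? w z) (adj? u z ×-dec adj? w z) (uz ,_)) adjacent))
      (codegree≤3 u≢w unique-N)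

  -- Edges between the non-neighbours and the neighbours of `u`.

  α+α≤1 : ∀ {w w′} → Adj w w′ → ∀ z → α w z + α w′ z ≤ 1
  α+α≤1 {w} {w′} ww′ z with adj? w z | adj? w′ z
  ... | yes wz | yes w′z = ⊥-elim (triangle-free ww′ w′z wz)
  ... | yes _  | no _    = ≤-refl
  ... | no _   | q       = χ≤1 q

  edge-disjoint : ∀ N {w w′} → Adj w w′ → ∑ N (α w) + ∑ N (α w′) ≤ length N
  edge-disjoint N {w} {w′} ww′ = begin
    ∑ N (α w) + ∑ N (α w′)      ≡⟨ ∑-+ N (α w) (α w′) ⟨
    ∑ N (λ z → α w z + α w′ z)  ≤⟨ ∑-≤-* N (α+α≤1 ww′) ⟩
    length N * 1                ≡⟨ *-identityʳ _ ⟩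
    length N                    ∎
    where open ≤-Reasoning

  -- A neighbour of w₂ in N is adjacent to neither w₁ nor w₃, and w₂ itself is already one of their
  -- at most three common neighbours.
  path-bound : ∀ {N w₁ w₂ w₃} → Unique (w₂ ∷ N) → w₁ ≢ w₃ → Adj w₁ w₂ → Adj w₂ w₃ →
               ∑ N (α w₁) + ∑ N (α w₂) + ∑ N (α w₃) ≤ length N + 2
  path-bound {N} {w₁} {w₂} {w₃} unique w₁≢w₃ a₁₂ a₂₃ = begin
    ∑ N (α w₁) + ∑ N (α w₂) + ∑ N (α w₃)      ≡⟨ cong (_+ ∑ N (α w₃)) (∑-+ N (α w₁) (α w₂)) ⟨
    ∑ N (λ z → α w₁ z + α w₂ z) + ∑ N (α w₃)  ≡⟨ ∑-+ N _ (α w₃) ⟨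
    ∑ N (λ z → α w₁ z + α w₂ z + α w₃ z)      ≤⟨ ∑-mono N pointwise ⟩
    ∑ N (λ z → 1 + χ (both? z))               ≡⟨ ∑-+ N (λ _ → 1) (χ ∘ both?) ⟩
    ∑ N (λ _ → 1) + ∑ N (χ ∘ both?)           ≡⟨ cong (_+ ∑ N (χ ∘ both?)) (trans (∑-const N 1) (*-identityʳ _)) ⟩
    length N + ∑ N (χ ∘ both?)                ≤⟨ +-monoʳ-≤ (length N) common ⟩
    length N + 2                              ∎
    where
    open ≤-Reasoning
    both? = λ z → adj? w₁ z ×-dec adj? w₃ z
    pointwise : ∀ z → α w₁ z + α w₂ z + α w₃ z ≤ 1 + χ (both? z)
    pointwise z with adj? w₁ z | adj? w₂ z | adj? w₃ z
    ... | yes p | yes q | _     = ⊥-elim (triangle-free a₁₂ q p)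
    ... | _     | yes q | yes r = ⊥-elim (triangle-free a₂₃ r q)
    ... | yes _ | no _  | yes _ = ≤-refl
    ... | yes _ | no _  | no _  = ≤-refl
    ... | no _  | yes _ | no _  = ≤-refl
    ... | no _  | no _  | yes _ = ≤-refl
    ... | no _  | no _  | no _  = z≤n
    common : ∑ N (χ ∘ both?) ≤ 2
    common = s≤s⁻¹ (subst (λ k → k + ∑ N (χ ∘ both?) ≤ 3) (χ-yes (both? w₂) (a₁₂ , adj-sym a₂₃))
                     (codegree≤3 w₁≢w₃ unique))

  -- Two rows missing the same column leave two columns adjacent to all four rows, a K₂₄;
  -- otherwise the eight vertices span K₄₄ minus three independent edges.
  no-three-almost-full-rows : ∀ {N u w₁ w₂ w₃} → length N ≡ 4 → Unique N → Unique (u ∷ w₁ ∷ w₂ ∷ w₃ ∷ []) →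
    All (Adj u) N → 3 ≤ ∑ N (α w₁) → 3 ≤ ∑ N (α w₂) → 3 ≤ ∑ N (α w₃) → ⊥
  no-three-almost-full-rows {N@(z ∷ zs@(_ ∷ _ ∷ _ ∷ []))} {u} {w₁} {w₂} {w₃} refl unique-N unique-W uN c₁ c₂ c₃
    with all-but-one (adj? w₁) z zs c₁ | all-but-one (adj? w₂) z zs c₂ | all-but-one (adj? w₃) z zs c₃
  ... | m₁ , f₁ | m₂ , f₂ | m₃ , f₃ = conclude (m₁ Fin.≟ m₂) (m₁ Fin.≟ m₃) (m₂ Fin.≟ m₃)
    where
    u-all : ∀ j → Adj u (lookup N j)
    u-all j = All.lookup uN (∈-lookup j)

    two-full : (∃₂ λ k l → k ≢ l × (k ≢ m₁ × k ≢ m₂ × k ≢ m₃) × (l ≢ m₁ × l ≢ m₂ × l ≢ m₃)) → ⊥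
    two-full (k , l , k≢l , (k₁ , k₂ , k₃) , (l₁ , l₂ , l₃)) = no-K₂₄ (lookup-≢ unique-N k≢l) unique-W
      ((adj-sym (u-all k) , adj-sym (u-all l)) ∷ (adj-sym (f₁ k₁) , adj-sym (f₁ l₁)) ∷
       (adj-sym (f₂ k₂) , adj-sym (f₂ l₂)) ∷ (adj-sym (f₃ k₃) , adj-sym (f₃ l₃)) ∷ [])

    conclude : Dec (m₁ ≡ m₂) → Dec (m₁ ≡ m₃) → Dec (m₂ ≡ m₃) → ⊥
    conclude (yes refl) _ _ with avoid-two m₁ m₃
    ... | k , l , k≢l , (k₁ , k₃) , (l₁ , l₃) = two-full (k , l , k≢l , (k₁ , k₁ , k₃) , (l₁ , l₁ , l₃))
    conclude _ (yes refl) _ with avoid-two m₁ m₂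
    ... | k , l , k≢l , (k₁ , k₂) , (l₁ , l₂) = two-full (k , l , k≢l , (k₁ , k₂ , k₁) , (l₁ , l₂ , l₁))
    conclude _ _ (yes refl) with avoid-two m₁ m₂
    ... | k , l , k≢l , (k₁ , k₂) , (l₁ , l₂) = two-full (k , l , k≢l , (k₁ , k₂ , k₂) , (l₁ , l₂ , l₂))
    conclude (no n₁₂) (no n₁₃) (no n₂₃) with avoid-three m₁ m₂ m₃
    ... | m₀ , n₀₁ , n₀₂ , n₀₃ = no-K₄₄-minus-3K₂ unique-W
      ((lookup-≢ unique-N n₀₁ ∷ lookup-≢ unique-N n₀₂ ∷ lookup-≢ unique-N n₀₃ ∷ []) ∷
       (lookup-≢ unique-N n₁₂ ∷ lookup-≢ unique-N n₁₃ ∷ []) ∷ (lookup-≢ unique-N n₂₃ ∷ []) ∷ [] ∷ [])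
      (u-all m₀ ∷ u-all m₁ ∷ u-all m₂ ∷ u-all m₃ ∷ [])
      (f₁ n₀₁ ∷ f₁ (n₁₂ ∘ sym) ∷ f₁ (n₁₃ ∘ sym) ∷ [])
      (f₂ n₀₂ ∷ f₂ n₁₂ ∷ f₂ (n₂₃ ∘ sym) ∷ [])
      (f₃ n₀₃ ∷ f₃ n₁₃ ∷ f₃ n₂₃ ∷ [])

  private
    third≥3 : ∀ {a b c} → a ≤ 3 → b ≤ 3 → 9 ≤ a + b + c → 3 ≤ c
    third≥3 {c = c} a≤3 b≤3 h = +-cancelˡ-≤ 6 3 c (≤-trans h (+-monoˡ-≤ c (+-mono-≤ a≤3 b≤3)))

    +-swap₁₂ : ∀ {k} a {b c} → b + a + c ≤ k → a + b + c ≤ k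
    +-swap₁₂ a {b} {c} = ≤-trans (≤-reflexive (cong (_+ c) (+-comm a b)))

    +-swap₂₃ : ∀ {k} a {b c} → a + c + b ≤ k → a + b + c ≤ k
    +-swap₂₃ a {b} {c} = ≤-trans (≤-reflexive (lemma a b c))
      where
      lemma : ∀ a b c → a + b + c ≡ a + c + b
      lemma = solve-∀

    +-rotate : ∀ {k} a {b c} → b + c + a ≤ k → a + b + c ≤ k
    +-rotate a {b} {c} = ≤-trans (≤-reflexive (trans (+-assoc a b c) (+-comm a (b + c))))

  -- Triangle-freeness allows at most two edges among the three `wᵢ`. Two form a path, giving 6 + 2;
  -- a single one gives 4 + 3 + 1; with none, each row is at most three and the total nine has to be
  -- excluded.
  edges-outside-star : ∀ {N u w₁ w₂ w₃} → length N ≡ 4 → Unique N → Unique (u ∷ w₁ ∷ w₂ ∷ w₃ ∷ []) →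
    All (Adj u) N → All (λ w → All (w ≢_) N) (w₁ ∷ w₂ ∷ w₃ ∷ []) →
    All (λ w → ∑ N (α w) ≤ 3) (w₁ ∷ w₂ ∷ w₃ ∷ []) →
    (∑ N (α w₁) + ∑ N (α w₂) + ∑ N (α w₃)) + (α w₁ w₂ + α w₁ w₃ + α w₂ w₃) ≤ 8
  edges-outside-star {N} {u} {w₁} {w₂} {w₃} |N| unique-N
    unique@((_ ∷ _ ∷ _ ∷ _) ∷ (n₁₂ ∷ n₁₃ ∷ _) ∷ (n₂₃ ∷ _) ∷ _) uN (d₁ ∷ d₂ ∷ d₃ ∷ []) (c₁ ∷ c₂ ∷ c₃ ∷ []) =
    cases (adj? w₁ w₂) (adj? w₁ w₃) (adj? w₂ w₃)
    where
    x y z : ℕ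
    x = ∑ N (α w₁)
    y = ∑ N (α w₂)
    z = ∑ N (α w₃)

    path : ∀ {w w′ w″} → Unique (w′ ∷ N) → w ≢ w″ → Adj w w′ → Adj w′ w″ →
           ∑ N (α w) + ∑ N (α w′) + ∑ N (α w″) ≤ 6
    path unique′ w≢w″ a a′ = ≤-trans (path-bound unique′ w≢w″ a a′) (≤-reflexive (cong (_+ 2) |N|))

    pair : ∀ {w w′} → Adj w w′ → ∑ N (α w) + ∑ N (α w′) ≤ 4
    pair a = ≤-trans (edge-disjoint N a) (≤-reflexive |N|)

    cases : (p : Dec (Adj w₁ w₂)) (q : Dec (Adj w₁ w₃)) (r : Dec (Adj w₂ w₃)) →
            (x + y + z) + (χ p + χ q + χ r) ≤ 8
    cases (yes p) (yes q) (yes r) = ⊥-elim (triangle-free p r q)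
    cases (yes p) (yes q) (no _)  = +-monoˡ-≤ 2 (+-swap₁₂ x (path (d₁ ∷ unique-N) n₂₃ (adj-sym p) q))
    cases (yes p) (no _)  (yes r) = +-monoˡ-≤ 2 (path (d₂ ∷ unique-N) n₁₃ p r)
    cases (no _)  (yes q) (yes r) = +-monoˡ-≤ 2 (+-swap₂₃ x (path (d₃ ∷ unique-N) n₁₂ q (adj-sym r)))
    cases (yes p) (no _)  (no _)  = +-monoˡ-≤ 1 (+-mono-≤ (pair p) c₃)
    cases (no _)  (yes q) (no _)  = +-monoˡ-≤ 1 (+-swap₂₃ x (+-mono-≤ (pair q) c₂))
    cases (no _)  (no _)  (yes r) = +-monoˡ-≤ 1 (+-rotate x (+-mono-≤ (pair r) c₁))
    -- A total of nine, with each row at most three, would force every row to be at least three.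
    cases (no _)  (no _)  (no _)  = ≤-trans (≤-reflexive (+-identityʳ (x + y + z)))
      (s≤s⁻¹ (≰⇒> λ h → no-three-almost-full-rows |N| unique-N unique uN
        (third≥3 c₂ c₃ (≤-trans h (+-rotate x ≤-refl)))
        (third≥3 c₁ c₃ (≤-trans h (+-swap₂₃ x ≤-refl)))
        (third≥3 c₁ c₂ h)))

  -- Degree sums for three, four, five, seven and eight vertices.

  module _ {vs} (S : Star vs) where
    open Star S

    private
      d = length N
      c = λ w → ∑ N (α w)
      -- The right side of `e-total` as a function of the list, to be evaluated on explicit short
      -- lists.
      T = λ X → 2 * (d + e⟨ X , N ⟩) + e⟨ X , X ⟩

    bound₁ : ∀ w → T (w ∷ []) ≡ 2 * (d + c w)
    bound₁ w = trans (cong (λ k → 2 * (d + (c w + 0)) + (k + 0 + 0)) (α-refl w)) (arith d (c w))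
      where arith : ∀ d x → 2 * (d + (x + 0)) + (0 + 0 + 0) ≡ 2 * (d + x)
            arith = solve-∀

    -- If `w₁` and `w₂` are not adjacent, they send at most 3 + 3 edges to `N`. If they are, their
    -- neighbourhoods in `N` are disjoint, so there are at most `d` such edges and one more between
    -- them, again at most six.
    bound₂ : ∀ {w₁ w₂} → c w₁ ≤ 3 → c w₂ ≤ 3 → d ≤ 5 → T (w₁ ∷ w₂ ∷ []) ≤ 2 * (d + 6)
    bound₂ {w₁} {w₂} h₁ h₂ d≤5 rewrite α-refl w₁ | α-refl w₂ | α-sym w₂ w₁ with adj? w₁ w₂
    ... | no _ = ≤-trans (≤-reflexive (arith d (c w₁) (c w₂))) (*-monoʳ-≤ 2 (+-monoʳ-≤ d (+-mono-≤ h₁ h₂)))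
      where arith : ∀ d x y → 2 * (d + (x + (y + 0))) + 0 ≡ 2 * (d + (x + y))
            arith = solve-∀
    ... | yes a = ≤-trans (≤-reflexive (arith d (c w₁) (c w₂))) (*-monoʳ-≤ 2 (+-monoʳ-≤ d (s≤s (≤-trans (edge-disjoint N a) d≤5))))
      where arith : ∀ d x y → 2 * (d + (x + (y + 0))) + 2 ≡ 2 * (d + (1 + (x + y)))
            arith = solve-∀

    bound₃ : ∀ {w₁ w₂ w₃} → W ≡ w₁ ∷ w₂ ∷ w₃ ∷ [] → d ≡ 4 → T W ≤ 24
    bound₃ {w₁} {w₂} {w₃} refl |N|
      rewrite α-refl w₁ | α-refl w₂ | α-refl w₃ | α-sym w₂ w₁ | α-sym w₃ w₁ | α-sym w₃ w₂ =
      ≤-trans (≤-reflexive (arith d (c w₁) (c w₂) (c w₃) (α w₁ w₂) (α w₁ w₃) (α w₂ w₃)))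
        (*-monoʳ-≤ 2 (+-mono-≤ (≤-reflexive |N|)
          (edges-outside-star |N| unique-N (u≢W ∷ unique-W) adjacent W≢N (All.map to-N≤3 u≢W))))
      where arith : ∀ d x y z a b c → 2 * (d + (x + (y + (z + 0)))) + (0 + (a + (b + 0)) + (a + (0 + (c + 0)) + (b + (c + (0 + 0)) + 0)))
                    ≡ 2 * (d + (x + y + z + (a + b + c)))
            arith = solve-∀

    |N|≡ : ∀ {n k} → length vs ≡ suc (k + n) → length W ≡ k → d ≡ n
    |N|≡ {n} {k} |vs| |W| = +-cancelʳ-≡ k d n (suc-injective (trans (cong (λ k → suc (d + k)) (sym |W|))
      (trans (sym length-split) (trans |vs| (cong suc (+-comm k n))))))

    |N|≤ : ∀ {n k} → length vs ≡ suc (k + n) → k ≤ length W → d ≤ n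
    |N|≤ {n} {k} |vs| k≤W = +-cancelʳ-≤ k d n (s≤s⁻¹ (≤-trans (s≤s (+-monoʳ-≤ d k≤W))
      (≤-reflexive (trans (sym length-split) (trans |vs| (cong suc (+-comm k n)))))))

    -- For large `W` the maximum degree is small, and the crude bound, number of vertices times
    -- maximum degree, suffices.
    total≤ : ∀ {b} n k → length vs ≡ suc (k + n) → k ≤ length W → suc (k + n) * n ≤ b → e⟨ vs , vs ⟩ ≤ b
    total≤ n k |vs| k≤W h = ≤-trans maximal (≤-trans (*-mono-≤ (≤-reflexive |vs|) (|N|≤ |vs| k≤W)) h)

    total₀ : ∀ {b} n → length vs ≡ suc n → W ≡ [] → 2 * n ≤ b → e⟨ vs , vs ⟩ ≤ b
    total₀ n |vs| refl h = ≤-trans (≤-reflexive (trans e-total (trans (+-identityʳ _) (cong (2 *_) (trans (+-identityʳ d) (|N|≡ |vs| refl)))))) h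

    -- The term `n ⊓ 3` arises because `w` sends at most `length N` edges to `N` and, by the
    -- codegree bound, at most three.
    total₁ : ∀ {b w} n → length vs ≡ 2 + n → W ≡ w ∷ [] → 2 * (n + n ⊓ 3) ≤ b → e⟨ vs , vs ⟩ ≤ b
    total₁ {w = w} n |vs| refl h with |N|≡ |vs| refl | u≢W
    ... | refl | u≢w ∷ [] = ≤-trans (≤-reflexive (trans e-total (bound₁ w)))
      (≤-trans (*-monoʳ-≤ 2 (+-monoʳ-≤ d (⊓-glb (≤-trans (∑-≤-* N (χ≤1 ∘ adj? w)) (≤-reflexive (*-identityʳ d))) (to-N≤3 u≢w)))) h)

    total₂ : ∀ {b w₁ w₂} n → length vs ≡ 3 + n → W ≡ w₁ ∷ w₂ ∷ [] → n ≤ 5 → 2 * (n + 6) ≤ b → e⟨ vs , vs ⟩ ≤ b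
    total₂ n |vs| refl n≤5 h with |N|≡ |vs| refl | u≢W
    ... | refl | u≢w₁ ∷ u≢w₂ ∷ [] = ≤-trans (≤-reflexive e-total) (≤-trans (bound₂ (to-N≤3 u≢w₁) (to-N≤3 u≢w₂) n≤5) h)

    -- The odd slack is harmless: the left side is at least twice the number of links.
    total-3 : length vs ≡ 3 → e⟨ vs , vs ⟩ ≤ 5
    total-3 |vs| with W in eq
    ... | []        = total₀ 2 |vs| eq (≤ᵇ⇒≤ _ _ _)
    ... | _ ∷ []    = total₁ 1 |vs| eq (≤ᵇ⇒≤ _ _ _)
    ... | _ ∷ _ ∷ _ = total≤ 0 2 |vs| (subst (λ W → 2 ≤ length W) (sym eq) (s≤s (s≤s z≤n))) (≤ᵇ⇒≤ _ _ _)

    total-4 : length vs ≡ 4 → e⟨ vs , vs ⟩ ≤ 9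
    total-4 |vs| with W in eq
    ... | []        = total₀ 3 |vs| eq (≤ᵇ⇒≤ _ _ _)
    ... | _ ∷ []    = total₁ 2 |vs| eq (≤ᵇ⇒≤ _ _ _)
    ... | _ ∷ _ ∷ _ = total≤ 1 2 |vs| (subst (λ W → 2 ≤ length W) (sym eq) (s≤s (s≤s z≤n))) (≤ᵇ⇒≤ _ _ _)

    total-5 : length vs ≡ 5 → e⟨ vs , vs ⟩ ≤ 13
    total-5 |vs| with W in eq
    ... | []        = total₀ 4 |vs| eq (≤ᵇ⇒≤ _ _ _)
    ... | _ ∷ []    = total₁ 3 |vs| eq (≤ᵇ⇒≤ _ _ _)
    ... | _ ∷ _ ∷ _ = total≤ 2 2 |vs| (subst (λ W → 2 ≤ length W) (sym eq) (s≤s (s≤s z≤n))) (≤ᵇ⇒≤ _ _ _)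

    total-7 : length vs ≡ 7 → e⟨ vs , vs ⟩ ≤ 21
    total-7 |vs| with W in eq
    ... | []            = total₀ 6 |vs| eq (≤ᵇ⇒≤ _ _ _)
    ... | _ ∷ []        = total₁ 5 |vs| eq (≤ᵇ⇒≤ _ _ _)
    ... | _ ∷ _ ∷ []    = total₂ 4 |vs| eq (≤ᵇ⇒≤ _ _ _) (≤ᵇ⇒≤ _ _ _)
    -- Seven vertices of degree at most three have degree sum at most 21, one more than twice ten:
    -- here the odd slack is used in full.
    ... | _ ∷ _ ∷ _ ∷ _ = total≤ 3 3 |vs| (subst (λ W → 3 ≤ length W) (sym eq) (s≤s (s≤s (s≤s z≤n)))) (≤ᵇ⇒≤ _ _ _)

    total-8 : length vs ≡ 8 → e⟨ vs , vs ⟩ ≤ 25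
    total-8 |vs| with W in eq
    ... | []                = total₀ 7 |vs| eq (≤ᵇ⇒≤ _ _ _)
    ... | _ ∷ []            = total₁ 6 |vs| eq (≤ᵇ⇒≤ _ _ _)
    ... | _ ∷ _ ∷ []        = total₂ 5 |vs| eq (≤ᵇ⇒≤ _ _ _) (≤ᵇ⇒≤ _ _ _)
    -- Here `u` has degree four and at most eight edges avoid it, twelve in all.
    ... | _ ∷ _ ∷ _ ∷ []    = ≤-trans (≤-reflexive e-total)
                                (≤-trans (bound₃ eq (|N|≡ |vs| (cong length eq))) (≤ᵇ⇒≤ _ _ _))
    ... | _ ∷ _ ∷ _ ∷ _ ∷ _ = total≤ 3 4 |vs| (subst (λ W → 4 ≤ length W) (sym eq) (s≤s (s≤s (s≤s (s≤s z≤n))))) (≤ᵇ⇒≤ _ _ _)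

  star : DecidableEquality V → ∀ {v vs} → v ∈ₗ vs → Unique vs → Star vs
  star _≟_ {v} {vs} v∈vs unique = record
    { u = u ; N = N ; W = W
    ; split = ↭-trans (↭-remove _≟_ unique u∈vs) (prep u (filter-split-↭ (adj? u) others))
    ; unique-N = Unique.filter⁺ (adj? u) unique-others
    ; unique-W = Unique.filter⁺ (¬? ∘ adj? u) unique-others
    ; u≢W = All.filter⁺ (¬? ∘ adj? u) (All.all-filter (¬? ∘ (u ≟_)) vs)
    ; adjacent = All.all-filter (adj? u) others
    ; nonadjacent = All.all-filter (¬? ∘ adj? u) others
    ; maximal = ≤-trans (∑-mono-All (f[xs]≤f[argmax] v vs))
                  (≤-reflexive (trans (∑-const vs (degree u)) (cong (length vs *_) degree-u)))
    }
    where
    degree = λ x → ∑ vs (α x)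
    -- `v` is the default value of `argmax`; since it belongs to `vs`, so does the maximiser.
    u      = argmax degree v vs
    others = filter (¬? ∘ (u ≟_)) vs
    N      = filter (adj? u) others
    W      = filter (¬? ∘ adj? u) others
    unique-others = Unique.filter⁺ (¬? ∘ (u ≟_)) unique
    u∈vs : u ∈ₗ vs
    u∈vs with argmax-sel degree v vs
    ... | inj₁ u≡v = subst (_∈ₗ vs) (sym u≡v) v∈vs
    ... | inj₂ u∈  = u∈
    degree-u : degree u ≡ length N
    degree-u = begin
      ∑ vs (α u)                     ≡⟨ ∑-↭ (α u) (↭-remove _≟_ unique u∈vs) ⟩
      α u u + ∑ others (α u)       ≡⟨ cong (_+ ∑ others (α u)) (α-refl u) ⟩
      ∑ others (χ ∘ adj? u)            ≡⟨ length-filter (adj? u) others ⟨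
      length N                         ∎
      where open ≡-Reasoning

-- The chosen edges of the hypergraph, their parts and triangles.

∈⇒∈⋃ : ∀ {n e} (As : Fin e → Subset n) {v} j → v ∈ As j → v ∈ ⋃ (tabulate As)
∈⇒∈⋃ As zero    v∈ = p⊆p∪q _ v∈
∈⇒∈⋃ As (suc j) v∈ = q⊆p∪q (As zero) _ (∈⇒∈⋃ (As ∘ suc) j v∈)

length-allFin : ∀ n → length (allFin n) ≡ n
length-allFin n = length-tabulate id

-- `root` chooses, for every vertex covered by the edges `As`, one of these edges through it.
module RainbowFree {n r e} (part : Fin n → Fin r) (E : Subset n → Set)
  (r-partite : IsRPartite part E) (linear : IsLinear E)
  (no-3 : NoRainbowCycle part E 3) (no-4 : NoRainbowCycle part E 4)
  (As : Fin e → Subset n) (As-injective : Injective _≡_ _≡_ As) (edge : ∀ j → E (As j))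
  (root : Fin n → Fin e) (root-∈ : ∀ {v} j → v ∈ As j → v ∈ As (root v)) where

  meet-unique : ∀ {i j} → i ≢ j → ∀ {u v} → u ∈ As i → v ∈ As i → u ∈ As j → v ∈ As j → u ≡ v
  meet-unique {i} {j} i≢j = linear (As i) (As j) (edge i) (edge j) (i≢j ∘ As-injective) _ _

  part-injective : ∀ j {u v} → u ∈ As j → v ∈ As j → part u ≡ part v → u ≡ v
  part-injective j {u} {v} u∈ v∈ eq with r-partite (As j) (edge j) (part v)
  ... | _ , _ , _ , only = trans (only u u∈ eq) (sym (only v v∈ refl))

  r≤∣edge∣ : ∀ j → r ≤ ∑ (allFin n) (λ v → χ (v ∈? As j))
  r≤∣edge∣ j = begin
    r                                                   ≡⟨ trans (∑-const (allFin r) 1) (trans (*-identityʳ _) (length-allFin r)) ⟨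
    ∑ (allFin r) (λ _ → 1)                              ≤⟨ ∑-mono (allFin r) some ⟩
    ∑ (allFin r) (λ i → ∑ (allFin n) (λ v → χ (d v i))) ≡⟨ ∑-swap (allFin r) (allFin n) _ ⟩
    ∑ (allFin n) (λ v → ∑ (allFin r) (λ i → χ (d v i))) ≤⟨ ∑-mono (allFin n) (λ v → ∑χ-unique (d v)
                                                            (λ p q → trans (sym (proj₂ p)) (proj₂ q)) (v ∈? As j) proj₁ (Unique.allFin⁺ r)) ⟩
    ∑ (allFin n) (λ v → χ (v ∈? As j))                  ∎
    where
    open ≤-Reasoning
    d : ∀ v i → Dec (v ∈ As j × part v ≡ i)
    d v i = (v ∈? As j) ×-dec (part v Fin.≟ i)
    some : ∀ i → 1 ≤ ∑ (allFin n) (λ v → χ (d v i))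
    some i with r-partite (As j) (edge j) i
    ... | v , v∈ , eq , _ = ≤-trans (≤-reflexive (sym (χ-yes (d v i) (v∈ , eq)))) (∈⇒≤∑ (λ v → χ (d v i)) (∈-allFin v))

  -- If `p` and `q` differ, linearity makes all three meeting points distinct. Any two of them share
  -- an edge and so lie in different parts: the triangle would be rainbow.
  no-triangle : ∀ {i j k} → i ≢ j → j ≢ k → i ≢ k → ∀ {p q s} →
    p ∈ As i → p ∈ As j → q ∈ As j → q ∈ As k → s ∈ As k → s ∈ As i → p ≡ q
  no-triangle {i} {j} {k} i≢j j≢k i≢k {p} {q} {s} pi pj qj qk sk si with p Fin.≟ q
  ... | yes p≡q = p≡q
  -- Distinct parts serve twice, for the rainbow condition here and for the distinctness of the
  -- vertices in `cycle`.
  ... | no  p≢q = ⊥-elim (no-3 cycle (lookup-injective part parts-distinct))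
    where
    p≢s : p ≢ s
    p≢s refl = p≢q (meet-unique j≢k pj qj sk qk)
    q≢s : q ≢ s
    q≢s refl = p≢q (meet-unique i≢j pi si pj qj)
    parts-distinct : AllPairs (λ x y → part x ≢ part y) (p ∷ q ∷ s ∷ [])
    parts-distinct = (p≢q ∘ part-injective j pj qj ∷ p≢s ∘ part-injective i pi si ∷ []) ∷
                     (q≢s ∘ part-injective k qk sk ∷ []) ∷ [] ∷ []
    cycle : Cycle E 3
    cycle = record
      { vtx      = lookup (p ∷ q ∷ s ∷ [])
      ; edg      = As ∘ lookup (j ∷ k ∷ i ∷ [])
      ; vtx-inj  = lookup-injective part parts-distinct ∘ cong part
      ; edg-inj  = lookup-injective id ((j≢k ∷ i≢j ∘ sym ∷ []) ∷ (i≢k ∘ sym ∷ []) ∷ [] ∷ []) ∘ As-injective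
      ; edg-E    = λ t → edge _
      ; vtx-here = λ { zero → pj ; (suc zero) → qk ; (suc (suc zero)) → si }
      ; vtx-next = λ { zero → qj ; (suc zero) → sk ; (suc (suc zero)) → pi }
      }

  -- The link graph of the chosen edges.

  Arc : Fin e → Fin e → Set
  Arc i j = ∃ λ v → root v ≡ i × i ≢ j × v ∈ As j

  arc? : ∀ i j → Dec (Arc i j)
  arc? i j = Fin.any? λ v → (root v Fin.≟ i) ×-dec ¬? (i Fin.≟ j) ×-dec (v ∈? As j)

  -- The unoriented form of `Arc`. It keeps the meeting vertex, whose part becomes the colour, and
  -- records which end is the root.
  record Link (i j : Fin e) : Set where
    constructor link
    field
      {point} : Fin n
      i≢j     : i ≢ j
      ∈ˡ      : point ∈ As i
      ∈ʳ      : point ∈ As j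
      rooted  : root point ≡ i ⊎ root point ≡ j
  open Link

  link? : ∀ i j → Dec (Link i j)
  link? i j = map′ from to (arc? i j ⊎-dec arc? j i)
    where
    from : Arc i j ⊎ Arc j i → Link i j
    from (inj₁ (v , refl , i≢j , v∈)) = link i≢j (root-∈ j v∈) v∈ (inj₁ refl)
    from (inj₂ (v , refl , j≢i , v∈)) = link (j≢i ∘ sym) v∈ (root-∈ i v∈) (inj₂ refl)
    to : Link i j → Arc i j ⊎ Arc j i
    to (link i≢j v∈i v∈j (inj₁ eq)) = inj₁ (_ , eq , i≢j , v∈j)
    to (link i≢j v∈i v∈j (inj₂ eq)) = inj₂ (_ , eq , i≢j ∘ sym , v∈i)

  -- Arcs in both directions would come from two vertices common to both edges. By linearity these
  -- coincide, yet a vertex has only one root.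
  arcs≤links : ∀ i j → χ (arc? i j) + χ (arc? j i) ≤ χ (link? i j)
  arcs≤links i j with arc? i j | arc? j i
  ... | yes (u , refl , i≢j , u∈) | yes (v , refl , _ , v∈) =
        ⊥-elim (i≢j (cong root (meet-unique i≢j (root-∈ j u∈) v∈ u∈ (root-∈ i v∈))))
  ... | yes _ | no _  = ≤-refl
  ... | no _  | yes _ = ≤-refl
  ... | no _  | no _  = z≤n

  link-sym : ∀ {i j} → Link i j → Link j i
  link-sym (link i≢j v∈i v∈j (inj₁ eq)) = link (i≢j ∘ sym) v∈j v∈i (inj₂ eq)
  link-sym (link i≢j v∈i v∈j (inj₂ eq)) = link (i≢j ∘ sym) v∈j v∈i (inj₁ eq)

  -- By `no-triangle` the three meeting points are one vertex, and its root would have to lie in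
  -- each of the pairs {x , y}, {y , z} and {x , z}.
  link-triangle-free : ∀ {x y z} → Link x y → Link y z → Link x z → ⊥
  link-triangle-free (link x≢y px py c) (link y≢z qy qz c′) (link x≢z sx sz c″)
    with no-triangle x≢y y≢z x≢z px py qy qz sz sx | no-triangle y≢z (x≢z ∘ sym) (x≢y ∘ sym) qy qz sz sx px py
  link-triangle-free (link x≢y px py (inj₁ refl)) (link y≢z qy qz (inj₁ eq)) (link x≢z sx sz c″) | refl | refl = x≢y eq
  link-triangle-free (link x≢y px py (inj₁ refl)) (link y≢z qy qz (inj₂ eq)) (link x≢z sx sz c″) | refl | refl = x≢z eq
  link-triangle-free (link x≢y px py (inj₂ refl)) (link y≢z qy qz c′) (link x≢z sx sz (inj₁ eq)) | refl | refl = x≢y (sym eq)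
  link-triangle-free (link x≢y px py (inj₂ refl)) (link y≢z qy qz c′) (link x≢z sx sz (inj₂ eq)) | refl | refl = y≢z eq

  -- If the meeting points coincide, all four edges pass through one vertex, whose root would lie in
  -- both {x , z} and {y , w}.
  points-row : ∀ {x y z w} → x ≢ y → z ≢ w →
    (xz : Link x z) (xw : Link x w) (yz : Link y z) (yw : Link y w) → point xz ≢ point xw
  points-row x≢y z≢w (link x≢z px pz c) (link x≢w qx qw _) (link y≢z sy sz _) (link y≢w ty tw c′) refl
    with no-triangle z≢w (y≢w ∘ sym) (y≢z ∘ sym) pz qw tw ty sy sz
  ... | refl with c | c′
  ...   | inj₁ refl | inj₁ eq = x≢y eq
  ...   | inj₁ refl | inj₂ eq = x≢w eq
  ...   | inj₂ refl | inj₁ eq = y≢z (sym eq)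
  ...   | inj₂ refl | inj₂ eq = z≢w eq

  -- A point shared by `xz` and `yz` lies in both `x` and `y`; `no-triangle` on `y`, `x`, `w`
  -- identifies it with the point of `xw`, which reduces the claim to rows.
  points-column : ∀ {x y z w} → x ≢ y → z ≢ w →
    (xz : Link x z) (xw : Link x w) (yz : Link y z) (yw : Link y w) → point xz ≢ point yz
  points-column x≢y z≢w xz xw yz yw eq = points-row x≢y z≢w xz xw yz yw
    (no-triangle (x≢y ∘ sym) (i≢j xw) (i≢j yw) (subst (_∈ _) (sym eq) (∈ˡ yz)) (∈ˡ xz) (∈ˡ xw) (∈ʳ xw) (∈ʳ yw) (∈ˡ yw))

  colour : ∀ {i j} → Link i j → Fin r
  colour = part ∘ point

  colours-row : ∀ {x y z w} → x ≢ y → z ≢ w →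
    (xz : Link x z) (xw : Link x w) (yz : Link y z) (yw : Link y w) → colour xz ≢ colour xw
  colours-row x≢y z≢w xz xw yz yw = points-row x≢y z≢w xz xw yz yw ∘ part-injective _ (∈ˡ xz) (∈ˡ xw)

  colours-column : ∀ {x y z w} → x ≢ y → z ≢ w →
    (xz : Link x z) (xw : Link x w) (yz : Link y z) (yw : Link y w) → colour xz ≢ colour yz
  colours-column x≢y z≢w xz xw yz yw = points-column x≢y z≢w xz xw yz yw ∘ part-injective _ (∈ʳ xz) (∈ʳ yz)

  -- Links that share an end already differ in colour. If both diagonal pairs differed as well, the
  -- four meeting points would form a rainbow 4-cycle along the edges `x`, `z`, `y`, `w`.
  colours-cross : ∀ {x y z w} → x ≢ y → z ≢ w →
    (xz : Link x z) (xw : Link x w) (yz : Link y z) (yw : Link y w) → colour xz ≡ colour yw ⊎ colour xw ≡ colour yz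
  colours-cross {x} {y} {z} {w} x≢y z≢w xz xw yz yw with colour xz Fin.≟ colour yw | colour xw Fin.≟ colour yz
  ... | yes eq | _      = inj₁ eq
  ... | no _   | yes eq = inj₂ eq
  ... | no p≢t | no q≢s = ⊥-elim (no-4 cycle (lookup-injective part parts-distinct))
    where
    parts-distinct : AllPairs (λ x y → part x ≢ part y) (point xw ∷ point xz ∷ point yz ∷ point yw ∷ [])
    parts-distinct =
      (colours-row x≢y (z≢w ∘ sym) xw xz yw yz ∷ q≢s ∷ colours-column x≢y (z≢w ∘ sym) xw xz yw yz ∷ []) ∷
      (colours-column x≢y z≢w xz xw yz yw ∷ p≢t ∷ []) ∷
      (colours-row (x≢y ∘ sym) z≢w yz yw xz xw ∷ []) ∷ [] ∷ []
    cycle : Cycle E 4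
    cycle = record
      { vtx      = lookup (point xw ∷ point xz ∷ point yz ∷ point yw ∷ [])
      ; edg      = As ∘ lookup (x ∷ z ∷ y ∷ w ∷ [])
      ; vtx-inj  = lookup-injective part parts-distinct ∘ cong part
      ; edg-inj  = lookup-injective id ((i≢j xz ∷ x≢y ∷ i≢j xw ∷ []) ∷ (i≢j yz ∘ sym ∷ z≢w ∷ []) ∷ (i≢j yw ∷ []) ∷ [] ∷ []) ∘ As-injective
      ; edg-E    = λ t → edge _
      ; vtx-here = λ { zero → ∈ˡ xw ; (suc zero) → ∈ʳ xz ; (suc (suc zero)) → ∈ˡ yz ; (suc (suc (suc zero))) → ∈ʳ yw }
      ; vtx-next = λ { zero → ∈ˡ xz ; (suc zero) → ∈ʳ yz ; (suc (suc zero)) → ∈ˡ yw ; (suc (suc (suc zero))) → ∈ʳ xw }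
      }

  linkGraph : ColouredGraph
  linkGraph = record
    { V = Fin e ; C = Fin r ; Adj = Link ; adj? = link? ; adj-sym = link-sym ; colour = colour
    ; triangle-free = link-triangle-free ; proper-row = colours-row ; proper-column = colours-column
    ; not-rainbow = colours-cross }

  -- Double counting of incidences and the size of the union.

  arcs : ℕ
  arcs = ∑ (allFin e) λ j → ∑ (allFin e) λ i → χ (arc? i j)

  arcs+arcs≤ : arcs + arcs ≤ Counting.e⟨_,_⟩ linkGraph (allFin e) (allFin e)
  arcs+arcs≤ = begin
    arcs + arcs                                                                ≡⟨ cong (_+ arcs) (∑-swap (allFin e) (allFin e) _) ⟩
    (∑ (allFin e) λ i → ∑ (allFin e) λ j → χ (arc? i j)) + arcs                ≡⟨ ∑-+ (allFin e) _ _ ⟨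
    ∑ (allFin e) (λ i → ∑ (allFin e) (λ j → χ (arc? i j)) + ∑ (allFin e) (λ j → χ (arc? j i)))
      ≡⟨ ∑-cong (allFin e) (λ i → ∑-+ (allFin e) (λ j → χ (arc? i j)) _) ⟨
    ∑ (allFin e) (λ i → ∑ (allFin e) (λ j → χ (arc? i j) + χ (arc? j i)))     ≤⟨ ∑-mono (allFin e) (λ i → ∑-mono (allFin e) (arcs≤links i)) ⟩
    Counting.e⟨_,_⟩ linkGraph (allFin e) (allFin e)                                    ∎
    where open ≤-Reasoning

  -- A vertex of `As j` either has root `j`, and such incidences number at most one for each vertex
  -- of the union, or has another root `i` and yields an arc from `i` to `j`. By linearity each arc
  -- arises from one vertex only.
  e*r≤∣⋃∣+arcs : e * r ≤ ∣ ⋃ (tabulate As) ∣ + arcs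
  e*r≤∣⋃∣+arcs = begin
    e * r                                              ≡⟨ trans (∑-const (allFin e) r) (cong (_* r) (length-allFin e)) ⟨
    ∑ (allFin e) (λ _ → r)                             ≤⟨ ∑-mono (allFin e) (λ j → ≤-trans (r≤∣edge∣ j) (per-edge j)) ⟩
    ∑ (allFin e) (λ j → own j + into j)                ≡⟨ ∑-+ (allFin e) own into ⟩
    ∑ (allFin e) own + arcs                            ≤⟨ +-monoˡ-≤ arcs own≤ ⟩
    ∣ ⋃ (tabulate As) ∣ + arcs                         ∎
    where
    open ≤-Reasoning
    own? : ∀ v j → Dec (v ∈ As j × root v ≡ j)
    own? v j = (v ∈? As j) ×-dec (root v Fin.≟ j)
    foreign? : ∀ j v i → Dec (root v ≡ i × i ≢ j × v ∈ As j)
    foreign? j v i = (root v Fin.≟ i) ×-dec ¬? (i Fin.≟ j) ×-dec (v ∈? As j)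
    own into : Fin e → ℕ
    own j  = ∑ (allFin n) λ v → χ (own? v j)
    into j = ∑ (allFin e) λ i → χ (arc? i j)

    per-vertex : ∀ j v → χ (v ∈? As j) ≤ χ (own? v j) + ∑ (allFin e) (λ i → χ (foreign? j v i))
    per-vertex j v with root v Fin.≟ j
    ... | yes eq = ≤-trans (χ-mono (v ∈? As j) ((v ∈? As j) ×-dec yes eq) (_, eq)) (m≤m+n _ _)
    ... | no root≢j = ≤-trans (χ-mono (v ∈? As j) (foreign? j v (root v)) (λ v∈ → refl , root≢j , v∈))
                        (≤-trans (∈⇒≤∑ (λ i → χ (foreign? j v i)) (∈-allFin (root v))) (m≤n+m _ _))

    per-edge : ∀ j → ∑ (allFin n) (λ v → χ (v ∈? As j)) ≤ own j + into j
    per-edge j = begin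
      ∑ (allFin n) (λ v → χ (v ∈? As j))                                      ≤⟨ ∑-mono (allFin n) (per-vertex j) ⟩
      ∑ (allFin n) (λ v → χ (own? v j) + ∑ (allFin e) (λ i → χ (foreign? j v i)))  ≡⟨ ∑-+ (allFin n) _ _ ⟩
      own j + ∑ (allFin n) (λ v → ∑ (allFin e) (λ i → χ (foreign? j v i)))    ≡⟨ cong (own j +_) (∑-swap (allFin n) (allFin e) _) ⟩
      own j + ∑ (allFin e) (λ i → ∑ (allFin n) (λ v → χ (foreign? j v i)))
        ≤⟨ +-monoʳ-≤ (own j) (∑-mono (allFin e) (λ i → ∑χ-unique (λ v → foreign? j v i) (foreign-unique i) (arc? i j) (λ p → _ , p) (Unique.allFin⁺ n))) ⟩
      own j + into j                                                          ∎
      where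
      foreign-unique : ∀ i {u v} → root u ≡ i × i ≢ j × u ∈ As j → root v ≡ i × i ≢ j × v ∈ As j → u ≡ v
      foreign-unique i {u} {v} (eq , i≢j , u∈) (eq′ , _ , v∈) = meet-unique i≢j
        (subst (λ i → u ∈ As i) eq (root-∈ j u∈)) (subst (λ i → v ∈ As i) eq′ (root-∈ j v∈)) u∈ v∈

    own≤ : ∑ (allFin e) own ≤ ∣ ⋃ (tabulate As) ∣
    own≤ = begin
      ∑ (allFin e) own                                          ≡⟨ ∑-swap (allFin e) (allFin n) _ ⟩
      ∑ (allFin n) (λ v → ∑ (allFin e) (λ j → χ (own? v j)))    ≤⟨ ∑-mono (allFin n) (λ v → ∑χ-unique (own? v) (λ p q → trans (sym (proj₂ p)) (proj₂ q))
                                                                     (v ∈? ⋃ (tabulate As)) (λ p → ∈⇒∈⋃ As _ (proj₁ p)) (Unique.allFin⁺ e)) ⟩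
      ∑ (allFin n) (λ v → χ (v ∈? ⋃ (tabulate As)))             ≡⟨ ∣p∣≡∑ (⋃ (tabulate As)) ⟨
      ∣ ⋃ (tabulate As) ∣                                       ∎

-- Here `k` bounds the number of links, while `bound` speaks of ordered pairs and leaves a slack of
-- one. There are `suc e` edges, so at least one.
GFree-from-links : ∀ {r n} (part : Fin n → Fin r) (E : Subset n → Set) → IsRPartite part E → IsLinear E →
  NoRainbowCycle part E 3 → NoRainbowCycle part E 4 → ∀ e k → suc k ≤ suc e * r →
  (∀ {G vs} → Counting.Star G vs → length vs ≡ suc e → Counting.e⟨_,_⟩ G vs vs ≤ suc (k + k)) →
  GFree E (suc e * r ∸ suc k) (suc e)
GFree-from-links {r} {n} part E r-partite linear no-3 no-4 e k k< bound As As-injective edge = begin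
  -- `k<` ensures that the truncated subtraction is exact.
  suc (suc e * r ∸ suc k)                   ≡⟨ +-∸-assoc 1 k< ⟨
  suc e * r ∸ k                             ≤⟨ ∸-monoˡ-≤ k (≤-trans e*r≤∣⋃∣+arcs (+-monoʳ-≤ ∣ ⋃ (tabulate As) ∣ arcs≤k)) ⟩
  ∣ ⋃ (tabulate As) ∣ + k ∸ k               ≡⟨ m+n∸n≡m ∣ ⋃ (tabulate As) ∣ k ⟩
  ∣ ⋃ (tabulate As) ∣                       ∎
  where
  open ≤-Reasoning
  rootOf : ∀ v → Dec (∃ λ j → v ∈ As j) → Fin (suc e)
  rootOf v (yes (j , _)) = j
  -- A default for vertices outside all the chosen edges.
  rootOf v (no _)        = zero
  rootOf-∈ : ∀ {v} j → v ∈ As j → (d : Dec (∃ λ j → v ∈ As j)) → v ∈ As (rootOf v d)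
  rootOf-∈ j v∈ (yes (_ , v∈′)) = v∈′
  rootOf-∈ j v∈ (no ∄)          = ⊥-elim (∄ (j , v∈))
  root? : ∀ v → Dec (∃ λ j → v ∈ As j)
  root? v = Fin.any? λ j → v ∈? As j
  open RainbowFree part E r-partite linear no-3 no-4 As As-injective edge
    (λ v → rootOf v (root? v)) (λ j v∈ → rootOf-∈ j v∈ (root? _))
  halve : ∀ {a b} → a + a ≤ suc (b + b) → a ≤ b
  halve {a} {b} h = ≮⇒≥ λ b<a → 1+n≰n (≤-trans (≤-trans (≤-reflexive (cong suc (sym (+-suc b b)))) (+-mono-≤ b<a b<a)) h)
  arcs≤k : arcs ≤ k
  arcs≤k = halve (≤-trans arcs+arcs≤ (bound (Counting.star linkGraph Fin._≟_ (∈-allFin zero) (Unique.allFin⁺ (suc e))) (length-allFin (suc e))))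

theorem3 : (r : ℕ) → 3 ≤ r → (n : ℕ) → (part : Fin n → Fin r) →
    (E : Subset n → Set) → IsRPartite part E → IsLinear E →
    NoRainbowCycle part E 3 → NoRainbowCycle part E 4 →
    GFree E (3 * r ∸ 3) 3 × GFree E (4 * r ∸ 5) 4 × GFree E (5 * r ∸ 7) 5 ×
    GFree E (7 * r ∸ 11) 7 × GFree E (8 * r ∸ 13) 8
theorem3 r 3≤r n part E r-partite linear no-3 no-4 =
    -- The first number is one less than the number of edges e; the second is the link bound 2e - 4.
    free 2 2 (≤ᵇ⇒≤ _ _ _) (Counting.total-3 _) , free 3 4 (≤ᵇ⇒≤ _ _ _) (Counting.total-4 _) , free 4 6 (≤ᵇ⇒≤ _ _ _) (Counting.total-5 _) ,
    free 6 10 (≤ᵇ⇒≤ _ _ _) (Counting.total-7 _) , free 7 12 (≤ᵇ⇒≤ _ _ _) (Counting.total-8 _)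
  where
  free : ∀ e k → suc k ≤ suc e * 3 →
    (∀ {G vs} → Counting.Star G vs → length vs ≡ suc e → Counting.e⟨_,_⟩ G vs vs ≤ suc (k + k)) →
    GFree E (suc e * r ∸ suc k) (suc e)
  free e k h = GFree-from-links part E r-partite linear no-3 no-4 e k (≤-trans h (*-monoʳ-≤ (suc e) 3≤r))
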